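{- Let $G$ be a connected block graph on $n$ vertices with blocks $B_1,\dots,B_t$ of orders $b_1,\dots,b_t$, and equip $V(G)$ with a Hamming labelling as described in the context. Let $S\subseteq V(G)$ with $|S|=k$, $2\le k\le n$. Then $$d(S)=\sum_{i=1}^t \ell_i(S) - t,$$ where $\ell_i(S)$ is the number of distinct values taken by the $i$-th coordinates of the labels of the vertices in $S$.
   Context: A block of a graph is a maximal connected induced subgraph without cut vertices; a block graph is a graph in which every block is a clique. For connected $G$ and $S\subseteq V(G)$, the Steiner distance $d(S)$ is the minimum number of edges of a connected subgraph of $G$ whose vertex set contains $S$. $G\setminus B_i$ denotes the graph obtained from $G$ by deleting all edges of block $B_i$; each connected component of $G\setminus B_i$ contains exactly one vertex of $B_i$. Hamming labelling: for each $i\in\{1,\dots,t\}$ choose an injective map $f_i:V(B_i)\to\{0,1,\dots,b_i-1\}$; for a vertex $u\in V(G)$, its $i$-th coordinate is $f_i(w)$, where $w$ is the unique vertex of $B_i$ lying in the connected component of $G\setminus B_i$ that contains $u$. The label of $u$ is the $t$-tuple of its coordinates (this gives an isometric embedding of $G$ into $K_{b_1}\square\cdots\square K_{b_t}$). -}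

module Defs where

open import Data.Fin.Base using (Fin)
open import Data.Fin.Properties using (_<?_; _≟_)
open import Data.Fin.Subset using (Subset; _∈_; _⊆_; _-_; ∣_∣; ⊤; Nonempty)
open import Data.Fin.Subset.Properties using (_∈?_; ∈⊤)
open import Data.List.Base
  using (length; filter; map; allFin; cartesianProduct; deduplicate)
open import Data.Nat.Base using (ℕ; _≤_)
open import Data.Product.Base using (Σ; ∃; ∃-syntax; _×_; _,_; proj₁)
open import Function.Definitions using (Injective)
open import Level using (0ℓ)
open import Relation.Binary.Core using (Rel; _⇒_)
open import Relation.Binary.Construct.Closure.ReflexiveTransitive
  using (Star; ε; _◅_)
open import Relation.Binary.Definitions using (Decidable; Symmetric; Irreflexive)
open import Relation.Binary.PropositionalEquality.Core using (_≡_; _≢_)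
open import Relation.Nullary.Decidable.Core using (yes; no; _×-dec_)
open import Relation.Nullary.Negation.Core using (¬_)

private
  variable
    n t : ℕ

record Graph (n : ℕ) : Set₁ where
  infix 4 _~_ _~?_
  field
    _~_    : Rel (Fin n) 0ℓ
    _~?_   : Decidable _~_
    sym    : Symmetric _~_
    irrefl : Irreflexive _≡_ _~_

ConnectedOn : Subset n → Rel (Fin n) 0ℓ → Set
ConnectedOn V E = Nonempty V × (∀ {u v} → u ∈ V → v ∈ V → Star E u v)

Connected : Graph n → Set
Connected G = ConnectedOn ⊤ (Graph._~_ G)

------------------------------------------------------------------------
-- Subgraphs and Steiner distance

record Subgraph (G : Graph n) : Set₁ where
  open Graph G using (_~_)
  field
    V     : Subset n
    E     : Rel (Fin n) 0ℓ
    E?    : Decidable E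
    E-sym : Symmetric E
    E⇒~   : E ⇒ _~_
    E⇒V   : ∀ {u v} → E u v → u ∈ V × v ∈ V

  -- Each undirected edge is counted once, as the pair with u < v.
  size : ℕ
  size = length (filter (λ (u , v) → (u <? v) ×-dec E? u v)
                        (cartesianProduct (allFin n) (allFin n)))

  ConnectedContaining : Subset n → Set
  ConnectedContaining S = ConnectedOn V E × S ⊆ V

IsSteinerDistance : Graph n → Subset n → ℕ → Set₁
IsSteinerDistance G S d =
    (∃[ H ] ConnectedContaining H S × size H ≡ d)
  × (∀ (H : Subgraph G) → ConnectedContaining H S → d ≤ size H)
  where open Subgraph {G = G}

------------------------------------------------------------------------
-- Blocks and block graphs

module _ (G : Graph n) where
  open Graph G

  Induced : Subset n → Rel (Fin n) 0ℓ
  Induced W u v = u ∈ W × v ∈ W × u ~ v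

  -- Deleting v from G[W] disconnects two vertices joined in G[W]; in
  -- particular the vertex of a one-vertex graph is not a cut vertex.
  CutVertex : Subset n → Fin n → Set
  CutVertex W v = v ∈ W × (∃[ x ] ∃[ y ] x ∈ W - v × y ∈ W - v
    × Star (Induced W) x y × ¬ Star (Induced (W - v)) x y)

  ConnectedWithoutCutVertices : Subset n → Set
  ConnectedWithoutCutVertices W =
    ConnectedOn W (Induced W) × (∀ v → ¬ CutVertex W v)

  IsBlock : Subset n → Set
  IsBlock B = ConnectedWithoutCutVertices B
    × (∀ W → ConnectedWithoutCutVertices W → B ⊆ W → W ⊆ B)

  IsClique : Subset n → Set
  IsClique W = ∀ {u v} → u ∈ W → v ∈ W → u ≢ v → u ~ v

  IsBlockGraph : Set
  IsBlockGraph = ∀ B → IsBlock B → IsClique B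

-- The list B₁ , … , Bₜ of all blocks, without repetition.
record BlockEnumeration (G : Graph n) (t : ℕ) : Set where
  field
    block     : Fin t → Subset n
    isBlock   : ∀ i → IsBlock G (block i)
    injective : Injective _≡_ _≡_ block
    complete  : ∀ W → IsBlock G W → ∃[ i ] block i ≡ W

------------------------------------------------------------------------
-- Hamming labellings

-- The edges of G∖B: an edge of G belongs to the block B exactly when both
-- of its ends do.
DeleteEdges : Graph n → Subset n → Rel (Fin n) 0ℓ
DeleteEdges G B u v = u ~ v × ¬ (u ∈ B × v ∈ B)
  where open Graph G

-- The first vertex of B on a walk from u into B lies in the component of
-- G∖B containing u.
firstHit : (G : Graph n) (B : Subset n) → ∀ {u b} → Star (Graph._~_ G) u b → b ∈ B →
           Σ (∃ (_∈ B)) λ w → Star (DeleteEdges G B) u (proj₁ w)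
firstHit G B ε b∈B = (_ , b∈B) , ε
firstHit G B {u} (e ◅ es) b∈B with u ∈? B
... | yes u∈B = (u , u∈B) , ε
... | no  u∉B =
  let w , walk = firstHit G B es b∈B
  in  w , (e , λ (u∈B , _) → u∉B u∈B) ◅ walk

-- A vertex of the block B in the component of G∖B containing u.  There is
-- only one such vertex, so the choice made by firstHit is immaterial.
representative : (G : Graph n) → Connected G → (B : Subset n) → IsBlock G B → (u : Fin n) →
                 Σ (∃ (_∈ B)) λ w → Star (DeleteEdges G B) u (proj₁ w)
representative G (_ , walk) B ((((b , b∈B) , _) , _) , _) u =
  firstHit G B (walk (∈⊤ {x = u}) (∈⊤ {x = b})) b∈B

record HammingLabelling {G : Graph n} (conn : Connected G)
                        (blocks : BlockEnumeration G t) : Set where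
  open BlockEnumeration blocks
  field
    f           : ∀ i → ∃ (_∈ block i) → Fin ∣ block i ∣
    f-injective : ∀ i → Injective _≡_ _≡_ (f i)

  label : Fin n → ∀ i → Fin ∣ block i ∣
  label u i = f i (proj₁ (representative G conn (block i) (isBlock i) u))

  ℓ : Fin t → Subset n → ℕ
  ℓ i S = length (deduplicate _≟_ (map (λ u → label u i) (filter (_∈? S) (allFin n))))

{-# OPTIONS --safe #-}

-- For a block B and a vertex u, call the vertex of B in the component of u in
-- G∖B the gate of u in B; an edge of G moves the gate in exactly one block.
-- Lower bound: explore a connected subgraph H from a vertex of S. The total
-- number of gates of the explored set starts at t and grows by at most one
-- with each new vertex, while each new vertex uses a new edge of H.
-- Upper bound: fix r in S. The edges from the gate of r to the gate of s, over
-- all blocks and all s in S, form a connected subgraph containing S, since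
-- those belonging to a single s make up a path from r to s.

module Submission where

open import Defs
open import Data.Nat.Base
  using (ℕ; zero; suc; _+_; _∸_; _≤_; _<_; z≤n; s≤s)
open import Data.Nat.Properties using (+-0-monoid)
import Data.Nat.Properties as ℕ
open import Data.Bool.Base using (true; false)
open import Data.Integer.Base using (+_; _-_; _⊖_)
import Data.Integer.Properties as ℤ
open import Data.Fin.Base as Fin using (Fin; zero; suc)
open import Data.Fin.Properties using (_≟_; _<?_; any?; <-cmp; <-asym)
open import Data.Fin.Subset
  using (Subset; ∣_∣; _⊆_; _∪_; ⁅_⁆; Nonempty)
  renaming (_∈_ to _∈ˢ_; _∉_ to _∉ˢ_; _-_ to _-ˢ_)
open import Data.Fin.Subset.Properties
  using (_∈?_; ∈⊤; x∈⁅x⁆; x∈⁅y⁆⇒x≡y; x∈p∪q⁻; p⊆p∪q; q⊆p∪q; p─q⊆p;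
         x∈p∧x≢y⇒x∈p-y; p⊂q⇒∣p∣<∣q∣; ∣p∣≤n; ⊆-antisym; nonempty?;
         Empty-unique; ∣⊥∣≡0)
open import Data.List.Base
  using (List; []; _∷_; length; map; filter; deduplicate; concat; tabulate;
         allFin; cartesianProduct)
open import Data.List.Membership.Propositional using (_∈_; _∉_)
open import Data.List.Membership.Propositional.Properties
  using (∈-map⁺; ∈-map⁻; ∈-filter⁺; ∈-filter⁻; ∈-allFin; ∈-concat⁺′;
         ∈-concat⁻′; ∈-tabulate⁺; ∈-tabulate⁻; ∈-cartesianProduct⁺;
         ∈-deduplicate⁺; ∈-deduplicate⁻)
import Data.List.Membership.DecPropositional as DecMembership
open import Data.List.Properties
  using (filter-notAll; filter-≐; length-filter; length-map; length-++)
open import Data.List.Relation.Binary.Subset.Propositional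
  using () renaming (_⊆_ to _⊆ˡ_)
open import Data.List.Relation.Binary.Subset.Propositional.Properties using (map⁺)
open import Data.List.Relation.Unary.All as All using (All; []; _∷_)
open import Data.List.Relation.Unary.Any as Any using (here; there)
open import Data.List.Relation.Unary.AllPairs using ([]; _∷_)
open import Data.List.Relation.Unary.Unique.Propositional using (Unique)
open import Data.List.Relation.Unary.Unique.Propositional.Properties
  using (filter⁺; cartesianProduct⁺; allFin⁺)
open import Data.List.Relation.Unary.Unique.DecPropositional.Properties
  using (deduplicate-!)
open import Data.Product.Base
  using (∃; ∃₂; _×_; _,_; ∃-syntax; proj₁; proj₂; swap)
open import Data.Product.Properties using (≡-dec)
open import Data.Sum.Base as Sum using (_⊎_; inj₁; inj₂)
open import Data.Vec.Base as Vec using ([]; _∷_; here; there)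
open import Data.Vec.Properties using (lookup⇒[]=; []=⇒lookup; lookup∘tabulate)
open import Data.Vec.Properties.WithK using ([]=-irrelevant)
open import Function.Base using (_∘_; id)
open import Level using (Level; 0ℓ)
open import Relation.Binary.Core using (Rel; _⇒_)
open import Relation.Binary.Construct.Closure.ReflexiveTransitive as Star
  using (Star; ε; _◅_; _◅◅_)
open import Relation.Binary.Definitions
  using (DecidableEquality; Symmetric; tri<; tri≈; tri>)
open import Relation.Binary.PropositionalEquality.Core
  using (_≡_; _≢_; refl; sym; trans; cong; subst)
open import Relation.Binary.PropositionalEquality.Properties using (module ≡-Reasoning)
open import Relation.Nullary.Decidable
  using (Dec; yes; no; does; proof; ¬?; decidable-stable; dec-true;
         _×-dec_; _⊎-dec_)
open import Relation.Nullary.Reflects using (Reflects; invert)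
open import Relation.Nullary.Negation using (¬_; contradiction)
open import Relation.Unary as Unary using (Pred)
open import Algebra.Properties.Monoid.Sum +-0-monoid using (sum-syntax; sum-cong-≗)

private
  variable
    a : Level
    A B C D : Set a
    n t : ℕ

-- Finite sums

∑-mono-≤ : (f g : Fin t → ℕ) → (∀ i → f i ≤ g i) → ∑[ i < t ] f i ≤ ∑[ i < t ] g i
∑-mono-≤ {zero}  f g f≤g = z≤n
∑-mono-≤ {suc t} f g f≤g =
  ℕ.+-mono-≤ (f≤g zero) (∑-mono-≤ (f ∘ suc) (g ∘ suc) (f≤g ∘ suc))

∑-≤-suc : (f g : Fin t → ℕ) (j : Fin t) → f j ≤ suc (g j) →
          (∀ i → i ≢ j → f i ≤ g i) → ∑[ i < t ] f i ≤ suc (∑[ i < t ] g i)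
∑-≤-suc f g zero    fj≤ f≤g =
  ℕ.+-mono-≤ fj≤ (∑-mono-≤ (f ∘ suc) (g ∘ suc) (λ i → f≤g (suc i) λ ()))
∑-≤-suc {suc t} f g (suc j) fj≤ f≤g = ℕ.≤-trans
  (ℕ.+-mono-≤ (f≤g zero λ ())
    (∑-≤-suc (f ∘ suc) (g ∘ suc) j fj≤ (λ i i≢j → f≤g (suc i) λ { refl → i≢j refl })))
  (ℕ.≤-reflexive (ℕ.+-suc (g zero) (∑[ i < t ] g (suc i))))

∑-suc : (f : Fin t → ℕ) → ∑[ i < t ] suc (f i) ≡ t + ∑[ i < t ] f i
∑-suc {zero}  f = refl
∑-suc {suc t} f = cong suc (trans (cong (_+_ (f zero)) (∑-suc (f ∘ suc)))
  (trans (sym (ℕ.+-assoc (f zero) t _))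
    (trans (cong (_+ ∑[ i < t ] f (suc i)) (ℕ.+-comm (f zero) t))
      (ℕ.+-assoc t (f zero) _))))

∑-zero : ∀ t → ∑[ i < t ] 0 ≡ 0
∑-zero zero    = refl
∑-zero (suc t) = ∑-zero t

length-concat-tabulate : (f : Fin t → List A) →
  length (concat (tabulate f)) ≡ ∑[ i < t ] length (f i)
length-concat-tabulate {zero}  f = refl
length-concat-tabulate {suc t} f =
  trans (length-++ (f zero)) (cong (_+_ (length (f zero))) (length-concat-tabulate (f ∘ suc)))

-- Counting in lists

-- Pigeonhole: striking the head of `xs` out of `ys` makes `ys` strictly shorter, and what is left
-- still contains the tail, whose entries all differ from the head.
Unique-⊆⇒length-≤ : DecidableEquality A → {xs ys : List A} →
                    Unique xs → xs ⊆ˡ ys → length xs ≤ length ys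
Unique-⊆⇒length-≤ _≟ᴬ_ {[]}     _           _     = z≤n
Unique-⊆⇒length-≤ _≟ᴬ_ {x ∷ xs} {ys} (x∉xs ∷ xs!) xs⊆ys = ℕ.≤-trans
  (s≤s (Unique-⊆⇒length-≤ _≟ᴬ_ xs!
    λ z∈xs → ∈-filter⁺ ≢x? (xs⊆ys (there z∈xs)) (All.lookup x∉xs z∈xs ∘ sym)))
  (filter-notAll ≢x? ys (Any.map (λ x≡y y≢x → y≢x (sym x≡y)) (xs⊆ys (here refl))))
  where
  ≢x? = λ y → ¬? (y ≟ᴬ x)

filter-map : {P : Pred B a} (P? : Unary.Decidable P) (f : A → B) (xs : List A) →
             filter P? (map f xs) ≡ map f (filter (P? ∘ f) xs)
filter-map P? f []       = refl
filter-map P? f (x ∷ xs) with does (P? (f x))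
... | true  = cong (f x ∷_) (filter-map P? f xs)
... | false = filter-map P? f xs

module _ (_≟ᴮ_ : DecidableEquality B) (f : A → B) where

  deduplicateOn : List A → List A
  deduplicateOn = deduplicate (λ x y → f x ≟ᴮ f y)

  deduplicate-map : ∀ xs → deduplicate _≟ᴮ_ (map f xs) ≡ map f (deduplicateOn xs)
  deduplicate-map []       = refl
  deduplicate-map (x ∷ xs) = cong (f x ∷_)
    (trans (cong (filter (λ y → ¬? (f x ≟ᴮ y))) (deduplicate-map xs))
           (filter-map (λ y → ¬? (f x ≟ᴮ y)) f (deduplicateOn xs)))

-- Maps that identify the same pairs make `deduplicate` keep the same positions of `xs`. This lets
-- labels be counted as gates.
length-deduplicate-cong :
  (_≟ᴮ_ : DecidableEquality B) (_≟ᶜ_ : DecidableEquality C) (f : A → B) (g : A → C) →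
  (∀ {x y} → f x ≡ f y → g x ≡ g y) → (∀ {x y} → g x ≡ g y → f x ≡ f y) → ∀ xs →
  length (deduplicate _≟ᴮ_ (map f xs)) ≡ length (deduplicate _≟ᶜ_ (map g xs))
length-deduplicate-cong _≟ᴮ_ _≟ᶜ_ f g f⇒g g⇒f xs = begin
  length (deduplicate _≟ᴮ_ (map f xs))     ≡⟨ lengths _≟ᴮ_ f ⟩
  length (deduplicateOn _≟ᴮ_ f xs)         ≡⟨ cong length (same xs) ⟩
  length (deduplicateOn _≟ᶜ_ g xs)         ≡⟨ lengths _≟ᶜ_ g ⟨
  length (deduplicate _≟ᶜ_ (map g xs))     ∎
  where
  open ≡-Reasoning
  lengths : (_≟ᴰ_ : DecidableEquality D) (h : _ → D) →
            length (deduplicate _≟ᴰ_ (map h xs)) ≡ length (deduplicateOn _≟ᴰ_ h xs)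
  lengths _≟ᴰ_ h = trans (cong length (deduplicate-map _≟ᴰ_ h xs)) (length-map h (deduplicateOn _≟ᴰ_ h xs))
  same : ∀ xs → deduplicateOn _≟ᴮ_ f xs ≡ deduplicateOn _≟ᶜ_ g xs
  same []       = refl
  same (x ∷ xs) = cong (x ∷_) (trans
    (filter-≐ (λ y → ¬? (f x ≟ᴮ f y)) (λ y → ¬? (g x ≟ᶜ g y))
      ((λ f≢ → f≢ ∘ g⇒f) , (λ g≢ → g≢ ∘ f⇒g)) (deduplicateOn _≟ᴮ_ f xs))
    (cong (filter (λ y → ¬? (g x ≟ᶜ g y))) (same xs)))

-- Subsets

-- The labelling maps act on a block vertex paired with a membership proof, while gates are compared
-- as bare vertices; this bridges the two.
∈ˢ-irrelevant : {p : Subset n} (v w : ∃ (_∈ˢ p)) → proj₁ v ≡ proj₁ w → v ≡ w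
∈ˢ-irrelevant (x , x∈p) (.x , x∈p′) refl = cong (x ,_) ([]=-irrelevant x∈p x∈p′)

x∉p-x : (p : Subset n) (x : Fin n) → x ∉ˢ p -ˢ x
x∉p-x (true  ∷ p) zero    ()
x∉p-x (false ∷ p) zero    ()
x∉p-x (_     ∷ p) (suc x) (there x∈) = x∉p-x p x x∈

x∈p-y⇒x≢y : {p : Subset n} {x y : Fin n} → x ∈ˢ p -ˢ y → x ≢ y
x∈p-y⇒x≢y {p = p} x∈ refl = x∉p-x p _ x∈

module _ {P : Pred (Fin n) a} (P? : Unary.Decidable P) where

  comprehension : Subset n
  comprehension = Vec.tabulate (does ∘ P?)

  ∈-comprehension⁺ : ∀ {x} → P x → x ∈ˢ comprehension
  ∈-comprehension⁺ {x} px =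
    lookup⇒[]= x comprehension (trans (lookup∘tabulate (does ∘ P?) x) (dec-true (P? x) px))

  ∈-comprehension⁻ : ∀ {x} → x ∈ˢ comprehension → P x
  ∈-comprehension⁻ {x} x∈ = invert (subst (Reflects (P x))
    (trans (sym (lookup∘tabulate (does ∘ P?) x)) ([]=⇒lookup x∈)) (proof (P? x)))

-- Blocks

-- P is the vertex set of the path.
data SimplePath {n} (E : Rel (Fin n) 0ℓ) : Fin n → Fin n → Subset n → Set where
  [_]  : ∀ x → SimplePath E x x ⁅ x ⁆
  step : ∀ {x y z P} → E x y → x ∉ˢ P → SimplePath E y z P →
         SimplePath E x z (⁅ x ⁆ ∪ P)

module _ {E : Rel (Fin n) 0ℓ} where

  start∈ : ∀ {x y P} → SimplePath E x y P → x ∈ˢ P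
  start∈ [ x ]        = x∈⁅x⁆ x
  start∈ (step _ _ _) = p⊆p∪q _ (x∈⁅x⁆ _)

  end∈ : ∀ {x y P} → SimplePath E x y P → y ∈ˢ P
  end∈ [ x ]        = x∈⁅x⁆ x
  end∈ (step _ _ p) = q⊆p∪q _ _ (end∈ p)

  suffix : ∀ {x y z P} → SimplePath E x y P → z ∈ˢ P → ∃ (SimplePath E z y)
  suffix [ x ] z∈ with refl ← x∈⁅y⁆⇒x≡y x z∈ = _ , [ x ]
  suffix {x} p@(step {P = P} _ _ p′) z∈ with x∈p∪q⁻ ⁅ x ⁆ P z∈
  ... | inj₁ z∈x with refl ← x∈⁅y⁆⇒x≡y x z∈x = _ , p
  ... | inj₂ z∈P = suffix p′ z∈P

  -- Loop erasure: when the new start already lies on the path, everything before that occurrence is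
  -- dropped.
  simplify : ∀ {x y} → Star E x y → ∃ (SimplePath E x y)
  simplify ε = _ , [ _ ]
  simplify {x} (e ◅ es) with P , p ← simplify es with x ∈? P
  ... | yes x∈P = suffix p x∈P
  ... | no  x∉P = _ , step e x∉P p

module _ (G : Graph n) where
  open Graph G using (_~_) renaming (sym to ~-sym)

  Induced-sym : {W : Subset n} → Symmetric (Induced G W)
  Induced-sym (x∈ , y∈ , e) = y∈ , x∈ , ~-sym e

  module _ {E : Rel (Fin n) 0ℓ} (E⇒~ : E ⇒ _~_) {U : Subset n} where

    walkToEnd : ∀ {x y z P} → SimplePath E x y P → P ⊆ U → z ∈ˢ P → Star (Induced G U) z y
    walkToEnd [ x ] _ z∈ with refl ← x∈⁅y⁆⇒x≡y x z∈ = ε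
    walkToEnd {x} (step {P = P} e _ p) P⊆U z∈ with x∈p∪q⁻ ⁅ x ⁆ P z∈
    ... | inj₁ z∈x with refl ← x∈⁅y⁆⇒x≡y x z∈x =
      (P⊆U (p⊆p∪q _ (x∈⁅x⁆ x)) , P⊆U (q⊆p∪q _ _ (start∈ p)) , E⇒~ e)
        ◅ walkToEnd p (P⊆U ∘ q⊆p∪q _ _) (start∈ p)
    ... | inj₂ z∈P = walkToEnd p (P⊆U ∘ q⊆p∪q _ _) z∈P

    -- A vertex z removed from a simple path occurs on it at most once, so one
    -- of the two directions from any other vertex avoids it.
    walkToAnEnd : ∀ {x y z a P} → SimplePath E x y P → (∀ {v} → v ∈ˢ P → v ≢ z → v ∈ˢ U) →
                  a ∈ˢ P → a ≢ z →
                  (x ≢ z × Star (Induced G U) a x) ⊎ (y ≢ z × Star (Induced G U) a y)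
    walkToAnEnd [ x ] _ a∈ a≢z with refl ← x∈⁅y⁆⇒x≡y x a∈ = inj₁ (a≢z , ε)
    walkToAnEnd {x} {z = z} (step {P = P} e x∉P p) P⊆U a∈ a≢z with x∈p∪q⁻ ⁅ x ⁆ P a∈
    ... | inj₁ a∈x with refl ← x∈⁅y⁆⇒x≡y x a∈x = inj₁ (a≢z , ε)
    ... | inj₂ a∈P with x ≟ z
    ...   | yes refl = inj₂ ((λ { refl → x∉P (end∈ p) }) ,
              walkToEnd p (λ v∈P → P⊆U (q⊆p∪q _ _ v∈P) λ { refl → x∉P v∈P }) a∈P)
    ...   | no x≢z with walkToAnEnd p (P⊆U ∘ q⊆p∪q _ _) a∈P a≢z
    ...     | inj₂ toEnd = inj₂ toEnd
    ...     | inj₁ (x′≢z , walk) = inj₁ (x≢z , walk ◅◅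
                (P⊆U (q⊆p∪q _ _ (start∈ p)) x′≢z ,
                 P⊆U (p⊆p∪q _ (x∈⁅x⁆ x)) x≢z , ~-sym (E⇒~ e)) ◅ ε)

  -- Any two vertices are joined by walking into the clique B from both.
  cliqueCore : {B W : Subset n} → Nonempty B → B ⊆ W → IsClique G B →
    (∀ {a} → a ∈ˢ W → ∃[ b ] b ∈ˢ B × Star (Induced G W) a b) →
    (∀ {a z} → a ∈ˢ W → a ≢ z → ∃[ b ] b ∈ˢ B × b ≢ z × Star (Induced G (W -ˢ z)) a b) →
    ConnectedWithoutCutVertices G W
  cliqueCore {B} {W} (b , b∈B) B⊆W clique reach reach-z =
    ((b , B⊆W b∈B) , λ u∈W v∈W →
      let b , b∈B , u→b = reach u∈W
          c , c∈B , v→c = reach v∈W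
      in u→b ◅◅ hop b∈B c∈B (B⊆W b∈B) (B⊆W c∈B) ◅◅ Star.reverse Induced-sym v→c)
    , λ where
      z (_ , x , y , x∈ , y∈ , _ , ¬x→y) →
        let b , b∈B , b≢z , x→b = reach-z (p─q⊆p W _ x∈) (x∈p-y⇒x≢y x∈)
            c , c∈B , c≢z , y→c = reach-z (p─q⊆p W _ y∈) (x∈p-y⇒x≢y y∈)
        in ¬x→y (x→b ◅◅ hop b∈B c∈B (x∈p∧x≢y⇒x∈p-y (B⊆W b∈B) b≢z)
                                    (x∈p∧x≢y⇒x∈p-y (B⊆W c∈B) c≢z)
                     ◅◅ Star.reverse Induced-sym y→c)
    where
    hop : ∀ {U x y} → x ∈ˢ B → y ∈ˢ B → x ∈ˢ U → y ∈ˢ U → Star (Induced G U) x y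
    hop {x = x} {y} x∈B y∈B x∈U y∈U with x ≟ y
    ... | yes refl = ε
    ... | no  x≢y  = (x∈U , y∈U , clique x∈B y∈B x≢y) ◅ ε

  clique-connected : {B : Subset n} → Nonempty B → IsClique G B →
                     ConnectedWithoutCutVertices G B
  clique-connected B≠∅ clique = cliqueCore B≠∅ id clique
    (λ a∈B → _ , a∈B , ε) (λ a∈B a≢z → _ , a∈B , a≢z , ε)

  -- The path is an ear on the clique: after the deletion of `z`, each remaining path vertex still
  -- reaches an end of the path other than `z`, and both ends lie in `B`.
  ∪-path-connected : {B P : Subset n} {w w′ : Fin n} → IsClique G B → w ∈ˢ B → w′ ∈ˢ B →
    SimplePath (DeleteEdges G B) w w′ P → ConnectedWithoutCutVertices G (B ∪ P)
  ∪-path-connected {B} {P} {w} {w′} clique w∈B w′∈B p =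
    cliqueCore (w , w∈B) (p⊆p∪q P) clique reach reach-z
    where
    reach : ∀ {a} → a ∈ˢ B ∪ P → ∃[ b ] b ∈ˢ B × Star (Induced G (B ∪ P)) a b
    reach a∈ with x∈p∪q⁻ B P a∈
    ... | inj₁ a∈B = _ , a∈B , ε
    ... | inj₂ a∈P = w′ , w′∈B , walkToEnd proj₁ p (q⊆p∪q B P) a∈P

    reach-z : ∀ {a z} → a ∈ˢ B ∪ P → a ≢ z →
              ∃[ b ] b ∈ˢ B × b ≢ z × Star (Induced G ((B ∪ P) -ˢ z)) a b
    reach-z a∈ a≢z with x∈p∪q⁻ B P a∈
    ... | inj₁ a∈B = _ , a∈B , a≢z , ε
    ... | inj₂ a∈P with walkToAnEnd proj₁ p (x∈p∧x≢y⇒x∈p-y ∘ q⊆p∪q B P) a∈P a≢z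
    ...   | inj₁ (w≢z  , walk) = w  , w∈B  , w≢z  , walk
    ...   | inj₂ (w′≢z , walk) = w′ , w′∈B , w′≢z , walk

  -- A simple path in G∖B with at least one edge and both ends in `B` could be added to `B`.
  -- Maximality then puts its second vertex into `B`, so its first edge has both ends in `B` and was
  -- deleted.
  component-unique : {B : Subset n} {w w′ : Fin n} → IsBlock G B → IsClique G B →
    w ∈ˢ B → w′ ∈ˢ B → Star (DeleteEdges G B) w w′ → w ≡ w′
  component-unique {B} (_ , maximal) clique w∈B w′∈B walk with simplify walk
  ... | _ , [ _ ] = refl
  ... | _ , p@(step (_ , w,x∉B) _ p′) = contradiction
    (w∈B , maximal _ (∪-path-connected clique w∈B w′∈B p) (p⊆p∪q _)
             (q⊆p∪q B _ (q⊆p∪q _ _ (start∈ p′))))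
    w,x∉B

  -- A vertex of B′ outside B would be joined to u and v in G∖B.
  block-⊆ : {B B′ : Subset n} {u v : Fin n} → IsBlock G B → IsClique G B → IsClique G B′ →
    u ≢ v → u ∈ˢ B → v ∈ˢ B → u ∈ˢ B′ → v ∈ˢ B′ → B′ ⊆ B
  block-⊆ {B} isB clique clique′ u≢v u∈B v∈B u∈B′ v∈B′ {x} x∈B′ =
    decidable-stable (x ∈? B) λ x∉B → u≢v (component-unique isB clique u∈B v∈B
      ((clique′ u∈B′ x∈B′ (λ { refl → x∉B u∈B }) , x∉B ∘ proj₂) ◅
       (clique′ x∈B′ v∈B′ (λ { refl → x∉B v∈B }) , x∉B ∘ proj₁) ◅ ε))

  -- Induction on `m`, which bounds the enlargements of `W` still possible, as no subset has more
  -- than `n` elements. The double negation avoids deciding maximality.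
  blockAround : ∀ m {W} → n < m + ∣ W ∣ → ConnectedWithoutCutVertices G W →
                ¬ ¬ (∃[ B ] IsBlock G B × W ⊆ B)
  blockAround zero    {W} n<∣W∣ _ _ = contradiction n<∣W∣ (ℕ.≤⇒≯ (∣p∣≤n W))
  blockAround (suc m) {W} n<    W-conn noBlock =
    -- If no block contains `W`, then `W` is itself maximal: by induction a larger `W′` would lie in
    -- a block, which would also contain `W`.
    noBlock (W , (W-conn , λ W′ W′-conn W⊆W′ {x} x∈W′ →
      decidable-stable (x ∈? W) λ x∉W →
        blockAround m
          (ℕ.≤-trans n< (ℕ.≤-trans (ℕ.≤-reflexive (sym (ℕ.+-suc m ∣ W ∣)))
            (ℕ.+-monoʳ-≤ m (p⊂q⇒∣p∣<∣q∣ (W⊆W′ , x , x∈W′ , x∉W)))))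
          W′-conn
          λ (B , isB , W′⊆B) → noBlock (B , isB , W′⊆B ∘ W⊆W′)) , id)

  edge-clique : ∀ {u v} → u ~ v → IsClique G (⁅ u ⁆ ∪ ⁅ v ⁆)
  edge-clique {u} {v} e {x} {y} x∈ y∈ x≢y
    with x∈p∪q⁻ ⁅ u ⁆ ⁅ v ⁆ x∈ | x∈p∪q⁻ ⁅ u ⁆ ⁅ v ⁆ y∈
  ... | inj₁ x∈u | inj₁ y∈u = contradiction (trans (x∈⁅y⁆⇒x≡y u x∈u) (sym (x∈⁅y⁆⇒x≡y u y∈u))) x≢y
  ... | inj₂ x∈v | inj₂ y∈v = contradiction (trans (x∈⁅y⁆⇒x≡y v x∈v) (sym (x∈⁅y⁆⇒x≡y v y∈v))) x≢y
  ... | inj₁ x∈u | inj₂ y∈v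
    with refl ← x∈⁅y⁆⇒x≡y u x∈u | refl ← x∈⁅y⁆⇒x≡y v y∈v = e
  ... | inj₂ x∈v | inj₁ y∈u
    with refl ← x∈⁅y⁆⇒x≡y v x∈v | refl ← x∈⁅y⁆⇒x≡y u y∈u = ~-sym e

  firstHit-fixed : ∀ {B u b} (walk : Star _~_ u b) (b∈B : b ∈ˢ B) → u ∈ˢ B →
                   proj₁ (proj₁ (firstHit G B walk b∈B)) ≡ u
  firstHit-fixed ε _ _ = refl
  firstHit-fixed {B} {u} (_ ◅ _) _ u∈B with u ∈? B
  ... | yes _  = refl
  ... | no u∉B = contradiction u∈B u∉B

  representative-fixed : ∀ (conn : Connected G) {B} (isB : IsBlock G B) {u} → u ∈ˢ B →
                         proj₁ (proj₁ (representative G conn B isB u)) ≡ u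
  representative-fixed (_ , walk) ((((_ , b∈B) , _) , _) , _) u∈B =
    firstHit-fixed (walk ∈⊤ ∈⊤) b∈B u∈B

-- Gates of vertices in blocks, and how they change along an edge

module Gates {n t} (G : Graph n) (conn : Connected G) (isBlockGraph : IsBlockGraph G)
             (blocks : BlockEnumeration G t) where
  open Graph G renaming (sym to ~-sym; irrefl to ~-irrefl)
  open BlockEnumeration blocks

  clique : ∀ i → IsClique G (block i)
  clique i = isBlockGraph (block i) (isBlock i)

  gate : Fin t → Fin n → Fin n
  gate i u = proj₁ (proj₁ (representative G conn (block i) (isBlock i) u))

  gate∈block : ∀ i u → gate i u ∈ˢ block i
  gate∈block i u = proj₂ (proj₁ (representative G conn (block i) (isBlock i) u))

  gate-fixed : ∀ {i u} → u ∈ˢ block i → gate i u ≡ u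
  gate-fixed {i} = representative-fixed G conn (isBlock i)

  DeleteEdges-sym : ∀ {B} → Symmetric (DeleteEdges G B)
  DeleteEdges-sym (e , ¬both) = ~-sym e , ¬both ∘ swap

  -- The edge survives in G∖B, so it joins the walks from `u` and `v` to their gates; both gates lie
  -- in one component, which meets the block only once.
  gate-edge : ∀ {i u v} → u ~ v → ¬ (u ∈ˢ block i × v ∈ˢ block i) → gate i u ≡ gate i v
  gate-edge {i} {u} {v} e ¬both =
    component-unique G (isBlock i) (clique i) (gate∈block i u) (gate∈block i v)
      (Star.reverse DeleteEdges-sym (toGate u) ◅◅ (e , ¬both) ◅ toGate v)
    where
    toGate : ∀ x → Star (DeleteEdges G (block i)) x (gate i x)
    toGate x = proj₂ (representative G conn (block i) (isBlock i) x)

  block-unique : ∀ {i j u v} → u ≢ v → u ∈ˢ block i → v ∈ˢ block i →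
                 u ∈ˢ block j → v ∈ˢ block j → i ≡ j
  block-unique {i} {j} u≢v u∈i v∈i u∈j v∈j = injective (⊆-antisym
    (block-⊆ G (isBlock j) (clique j) (clique i) u≢v u∈j v∈j u∈i v∈i)
    (block-⊆ G (isBlock i) (clique i) (clique j) u≢v u∈i v∈i u∈j v∈j))

  ~⇒≢ : ∀ {u v} → u ~ v → u ≢ v
  ~⇒≢ e refl = ~-irrefl refl e

  gate-elsewhere : ∀ {i j u v} → u ~ v → u ∈ˢ block j → v ∈ˢ block j → i ≢ j →
                   gate i u ≡ gate i v
  gate-elsewhere e u∈j v∈j i≢j =
    gate-edge e λ (u∈i , v∈i) → i≢j (block-unique (~⇒≢ e) u∈i v∈i u∈j v∈j)

  -- The two ends form a clique, which has a block around it up to double negation. Searching the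
  -- finitely many enumerated blocks is decidable, so the double negation can be removed.
  edge-block : ∀ {u v} → u ~ v → ∃[ j ] u ∈ˢ block j × v ∈ˢ block j
  edge-block {u} {v} e =
    decidable-stable (any? λ j → (u ∈? block j) ×-dec (v ∈? block j)) λ none →
      blockAround G (suc n) (s≤s (ℕ.m≤m+n n _))
        (clique-connected G (u , p⊆p∪q _ (x∈⁅x⁆ u)) (edge-clique G e))
        λ (B , isB , uv⊆B) → let j , j≡B = complete B isB in
          none (j , subst (u ∈ˢ_) (sym j≡B) (uv⊆B (p⊆p∪q _ (x∈⁅x⁆ u)))
                  , subst (v ∈ˢ_) (sym j≡B) (uv⊆B (q⊆p∪q _ _ (x∈⁅x⁆ v))))

  gates : Fin t → List (Fin n) → ℕ
  gates i X = length (deduplicate _≟_ (map (gate i) X))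

  gates-mono : ∀ i {X Y} → map (gate i) X ⊆ˡ map (gate i) Y → gates i X ≤ gates i Y
  gates-mono i {X} X⊆Y = Unique-⊆⇒length-≤ _≟_ (deduplicate-! _≟_ (map (gate i) X))
    (∈-deduplicate⁺ _≟_ ∘ X⊆Y ∘ ∈-deduplicate⁻ _≟_ (map (gate i) X))

  gates-⊆ : ∀ i {X Y} → X ⊆ˡ Y → gates i X ≤ gates i Y
  gates-⊆ i X⊆Y = gates-mono i (map⁺ (gate i) X⊆Y)

  gates-∷ : ∀ i {u v X} → u ∈ X → gate i u ≡ gate i v → gates i (v ∷ X) ≤ gates i X
  gates-∷ i {u} {v} {X} u∈X eq = gates-mono i λ where
    (here refl) → subst (_∈ map (gate i) X) eq (∈-map⁺ (gate i) u∈X)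
    (there w∈)  → w∈

  -- In every block but the one holding the edge, `v` shares the gate of `u`, which is already
  -- counted.
  ∑-gates-∷ : ∀ {u v X} → u ~ v → u ∈ X →
              ∑[ i < t ] gates i (v ∷ X) ≤ suc (∑[ i < t ] gates i X)
  ∑-gates-∷ {u} {v} {X} e u∈X = let j , u∈j , v∈j = edge-block e in
    ∑-≤-suc (λ i → gates i (v ∷ X)) (λ i → gates i X) j
      -- In block `j`, `deduplicate` puts the gate of `v` in front of a filtered copy of the old
      -- list of gates, so the count grows by at most one.
      (s≤s (length-filter _ (deduplicate _≟_ (map (gate j) X))))
      (λ i i≢j → gates-∷ i u∈X (gate-elsewhere e u∈j v∈j i≢j))

  -- Each `f i` is injective, so two labels agree in coordinate `i` exactly when the gates agree.
  gates≡ℓ : (labelling : HammingLabelling conn blocks) (S : Subset n) → ∀ i →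
            gates i (filter (_∈? S) (allFin n)) ≡ HammingLabelling.ℓ labelling i S
  gates≡ℓ labelling S i = length-deduplicate-cong _≟_ _≟_ (gate i) (λ u → label u i)
    (cong (f i) ∘ ∈ˢ-irrelevant _ _) (cong proj₁ ∘ f-injective i) (filter (_∈? S) (allFin n))
    where open HammingLabelling labelling

-- Lower bound: exploring a connected subgraph

edges : {G : Graph n} → Subgraph G → List (Fin n × Fin n)
edges {n} H = filter (λ (u , v) → (u <? v) ×-dec Subgraph.E? H u v)
                     (cartesianProduct (allFin n) (allFin n))

_≟ₑ_ : DecidableEquality (Fin n × Fin n)
_≟ₑ_ = ≡-dec _≟_ _≟_

module Exploration {n t} {G : Graph n} (conn : Connected G) (isBlockGraph : IsBlockGraph G)
                   (blocks : BlockEnumeration G t) (H : Subgraph G) where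
  open Gates G conn isBlockGraph blocks
  open Subgraph H
  open DecMembership (_≟_ {n}) using () renaming (_∈?_ to _∈ˡ?_)

  -- The invariant of the exploration. Keeping the ends of all used edges inside `X` is what makes
  -- an edge to a vertex outside `X` a new one.
  record Explored (X : List (Fin n)) : Set where
    field
      used      : List (Fin n × Fin n)
      used!     : Unique used
      used⊆     : used ⊆ˡ edges H
      endpoints : All (λ (u , v) → u ∈ X × v ∈ X) used
      bound     : ∑[ i < t ] gates i X ≤ t + length used

  ∈-edges : ∀ {u v} → u Fin.< v → E u v → (u , v) ∈ edges H
  ∈-edges {u} {v} u<v e =
    ∈-filter⁺ _ (∈-cartesianProduct⁺ (∈-allFin u) (∈-allFin v)) (u<v , e)

  singleton : ∀ r → Explored (r ∷ [])
  singleton r = record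
    { used = [] ; used! = [] ; used⊆ = λ () ; endpoints = []
    -- A single vertex has one gate in each of the `t` blocks.
    ; bound = ℕ.≤-reflexive (trans (∑-suc {t} (λ _ → 0)) (cong (_+_ t) (∑-zero t))) }

  addEdge : ∀ {u v X} → u ∈ X → v ∉ X → E u v → Explored X → Explored (v ∷ X)
  addEdge {u} {v} {X} u∈X v∉X e ex = extend oriented
    where
    open Explored ex
    -- `edges H` lists the smaller end first, so the new vertex `v` may be either component of the
    -- pair.
    oriented : ∃₂ λ x y → (x , y) ∈ edges H × (v ≡ x ⊎ v ≡ y) × x ∈ v ∷ X × y ∈ v ∷ X
    oriented with <-cmp u v
    ... | tri< u<v _ _    = u , v , ∈-edges u<v e , inj₂ refl , there u∈X , here refl
    ... | tri≈ _ refl _   = contradiction u∈X v∉X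
    ... | tri> _ _ v<u    = v , u , ∈-edges v<u (E-sym e) , inj₁ refl , here refl , there u∈X

    extend : (∃₂ λ x y → (x , y) ∈ edges H × (v ≡ x ⊎ v ≡ y) × x ∈ v ∷ X × y ∈ v ∷ X) →
             Explored (v ∷ X)
    extend (x , y , xy∈ , v≡ , x∈ , y∈) = record
      { used      = (x , y) ∷ used
      -- A used edge equal to the new one would have `v` as an end and hence `v` in `X`.
      ; used!     = All.map (λ (z∈X , w∈X) → λ { refl → v∉X
                      (Sum.[ (λ { refl → z∈X }) , (λ { refl → w∈X }) ] v≡) }) endpoints
                    ∷ used!
      ; used⊆     = λ { (here refl) → xy∈ ; (there z∈) → used⊆ z∈ }
      ; endpoints = (x∈ , y∈) ∷ All.map (λ (z∈X , w∈X) → there z∈X , there w∈X) endpoints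
      ; bound     = ℕ.≤-trans (∑-gates-∷ (E⇒~ e) u∈X)
                      (ℕ.≤-trans (s≤s bound) (ℕ.≤-reflexive (sym (ℕ.+-suc t _))))
      }

  -- Only steps to unexplored vertices use up an edge; a step to a vertex of `X` leaves the explored
  -- set as it is.
  follow : ∀ {u v X} → Star E u v → u ∈ X → Explored X →
           ∃[ Y ] X ⊆ˡ Y × v ∈ Y × Explored Y
  follow {X = X} ε u∈X ex = X , id , u∈X , ex
  follow {X = X} (_◅_ {j = w} e es) u∈X ex with w ∈ˡ? X
  ... | yes w∈X = follow es w∈X ex
  ... | no  w∉X =
    let Y , wX⊆Y , v∈Y , ex′ = follow es (here refl) (addEdge u∈X w∉X e ex)
    in  Y , wX⊆Y ∘ there , v∈Y , ex′

  visit : ∀ {r X} ys → All (Star E r) ys → r ∈ X → Explored X →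
          ∃[ Y ] X ⊆ˡ Y × ys ⊆ˡ Y × Explored Y
  visit {X = X} [] [] _ ex = X , id , (λ ()) , ex
  visit (y ∷ ys) (walk ∷ walks) r∈X ex =
    let Y , X⊆Y , y∈Y , ex′    = follow walk r∈X ex
        Z , Y⊆Z , ys⊆Z , ex″ = visit ys walks (X⊆Y r∈X) ex′
    in  Z , Y⊆Z ∘ X⊆Y , (λ { (here refl) → Y⊆Z y∈Y ; (there z∈) → ys⊆Z z∈ }) , ex″

  -- The explored set contains `ys`, so it has at least as many gates, and its used edges are
  -- distinct edges of `H`.
  ∑-gates-≤-size : ∀ {r} ys → All (Star E r) ys → ∑[ i < t ] gates i ys ≤ t + size
  ∑-gates-≤-size {r} ys walks with visit ys walks (here refl) (singleton r)
  ... | Y , _ , ys⊆Y , ex = ℕ.≤-trans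
    (∑-mono-≤ (λ i → gates i ys) (λ i → gates i Y) (λ i → gates-⊆ i ys⊆Y))
    (ℕ.≤-trans bound (ℕ.+-monoʳ-≤ t (Unique-⊆⇒length-≤ _≟ₑ_ used! used⊆)))
    where open Explored ex

-- Paths made of one edge per block in which the gates of the two ends differ

module Geodesics {n t} (G : Graph n) (conn : Connected G) (isBlockGraph : IsBlockGraph G)
                 (blocks : BlockEnumeration G t) where
  open Graph G using (_~_)
  open BlockEnumeration blocks using (block)
  open Gates G conn isBlockGraph blocks

  -- The edges of the shortest path from u to v.
  Turn : Fin n → Fin n → Rel (Fin n) 0ℓ
  Turn u v x y = ∃[ i ] x ≡ gate i u × y ≡ gate i v × x ≢ y

  -- The initial part of the walk, up to its edge in the block j; that edge can
  -- only be missing if u and v have the same gate in the block j.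
  toGate : ∀ j {u v v′ x} → (∀ i → i ≢ j → gate i v ≡ gate i v′) →
           (gate j v ≡ gate j u → v ≡ gate j u) → gate j x ≡ gate j u →
           Star (Turn u v) x v → Star (Turn u v′) x (gate j u)
  toGate j same atEnd x≈u ε = subst (Star _ _) (atEnd x≈u) ε
  toGate j {u} {v} same atEnd x≈u ((i , refl , refl , x≢y) ◅ es) with i ≟ j
  ... | yes refl = ε
  ... | no  i≢j  = (i , refl , same i i≢j , x≢y) ◅ toGate j same atEnd
    (trans (sym (gate-elsewhere (clique i (gate∈block i u) (gate∈block i v) x≢y)
                                (gate∈block i u) (gate∈block i v) (i≢j ∘ sym))) x≈u)
    es

  -- Passing from `v` to `v′` changes the gate only in the block `j` of that edge. The old path is
  -- therefore kept as far as the gate of `u` in `j`, and then a single edge inside `j`, if any,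
  -- leads to `v′`.
  extend : ∀ {u v v′} → v ~ v′ → Star (Turn u v) u v → Star (Turn u v′) u v′
  extend {u} {v} {v′} e walk = let j , v∈j , v′∈j = edge-block e in
    toGate j (λ i i≢j → gate-elsewhere e v∈j v′∈j i≢j)
             (trans (sym (gate-fixed v∈j))) refl walk
      ◅◅ lastStep j v′∈j
    where
    lastStep : ∀ j → v′ ∈ˢ block j → Star (Turn u v′) (gate j u) v′
    lastStep j v′∈j with gate j u ≟ v′
    ... | yes eq = subst (Star _ _) eq ε
    ... | no neq = (j , refl , sym (gate-fixed v′∈j) , neq) ◅ ε

  extend* : ∀ {u v w} → Star _~_ v w → Star (Turn u v) u v → Star (Turn u w) u w
  extend* ε        walk = walk
  extend* (e ◅ es) walk = extend* es (extend e walk)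

  -- The path is updated along an arbitrary walk of `G` from `u` to `v`, starting from the empty
  -- path at `u`.
  geodesic : ∀ u v → Star (Turn u v) u v
  geodesic u v = extend* (proj₂ conn ∈⊤ ∈⊤) ε

-- Upper bound: a Steiner tree assembled from stars in the blocks

module SteinerTree {n t} (G : Graph n) (conn : Connected G) (isBlockGraph : IsBlockGraph G)
                   (blocks : BlockEnumeration G t)
                   (S : Subset n) {r : Fin n} (r∈S : r ∈ˢ S) where
  open Graph G using (_~_) renaming (sym to ~-sym)
  open Gates G conn isBlockGraph blocks
  open Geodesics G conn isBlockGraph blocks
  open DecMembership (_≟ₑ_ {n}) using () renaming (_∈?_ to _∈ₑ?_)

  elements : List (Fin n)
  elements = filter (_∈? S) (allFin n)

  ∈-elements⁺ : ∀ {s} → s ∈ˢ S → s ∈ elements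
  ∈-elements⁺ {s} s∈S = ∈-filter⁺ (_∈? S) (∈-allFin s) s∈S

  ∈-elements⁻ : ∀ {s} → s ∈ elements → s ∈ˢ S
  ∈-elements⁻ s∈ = proj₂ (∈-filter⁻ (_∈? S) {xs = allFin n} s∈)

  gatesOf otherGates : Fin t → List (Fin n)
  gatesOf i    = deduplicate _≟_ (map (gate i) elements)
  otherGates i = filter (λ x → ¬? (x ≟ gate i r)) (gatesOf i)

  star : Fin t → List (Fin n × Fin n)
  star i = map (gate i r ,_) (otherGates i)

  arcs : List (Fin n × Fin n)
  arcs = concat (tabulate star)

  -- Since `r` lies in `S`, its own gate is among those counted in each block, and the star there
  -- has no arc to it. This saves one per block, `t` in total.
  length-arcs : t + length arcs ≤ ∑[ i < t ] gates i elements
  length-arcs = begin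
    t + length arcs                      ≡⟨ cong (_+_ t) (length-concat-tabulate star) ⟩
    t + ∑[ i < t ] length (star i)       ≡⟨ ∑-suc (length ∘ star) ⟨
    ∑[ i < t ] suc (length (star i))     ≤⟨ ∑-mono-≤ (suc ∘ length ∘ star) _ length-star ⟩
    ∑[ i < t ] gates i elements          ∎
    where
    open ℕ.≤-Reasoning
    length-star : ∀ i → suc (length (star i)) ≤ gates i elements
    length-star i = ℕ.≤-trans (s≤s (ℕ.≤-reflexive (length-map _ (otherGates i))))
      (filter-notAll (λ x → ¬? (x ≟ gate i r)) (gatesOf i)
        (Any.map (λ eq ≢r → ≢r (sym eq))
          (∈-deduplicate⁺ _≟_ (∈-map⁺ (gate i) (∈-elements⁺ r∈S)))))

  ∈-arcs⁺ : ∀ {s u v} → s ∈ˢ S → Turn r s u v → (u , v) ∈ arcs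
  ∈-arcs⁺ s∈S (i , refl , refl , u≢v) = ∈-concat⁺′
    (∈-map⁺ (gate i r ,_) (∈-filter⁺ _
      (∈-deduplicate⁺ _≟_ (∈-map⁺ (gate i) (∈-elements⁺ s∈S))) (u≢v ∘ sym)))
    (∈-tabulate⁺ i)

  ∈-arcs⁻ : ∀ {u v} → (u , v) ∈ arcs → ∃[ s ] s ∈ˢ S × Turn r s u v
  ∈-arcs⁻ uv∈ with xs , uv∈xs , xs∈ ← ∈-concat⁻′ (tabulate star) uv∈
                 with i , refl ← ∈-tabulate⁻ xs∈
                 with y , y∈ , refl ← ∈-map⁻ (gate i r ,_) uv∈xs
                 with y∈′ , y≢ ← ∈-filter⁻ _ {xs = gatesOf i} y∈
                 with s , s∈ , refl ← ∈-map⁻ (gate i) (∈-deduplicate⁻ _≟_ (map (gate i) elements) y∈′)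
    = s , ∈-elements⁻ s∈ , i , refl , refl , y≢ ∘ sym

  TreeEdge : Rel (Fin n) 0ℓ
  TreeEdge u v = (u , v) ∈ arcs ⊎ (v , u) ∈ arcs

  treeEdge? : ∀ u v → Dec (TreeEdge u v)
  treeEdge? u v = ((u , v) ∈ₑ? arcs) ⊎-dec ((v , u) ∈ₑ? arcs)

  TreeEdge-sym : Symmetric TreeEdge
  TreeEdge-sym = Sum.swap

  arc⇒~ : ∀ {u v} → (u , v) ∈ arcs → u ~ v
  arc⇒~ uv∈ with s , _ , i , refl , refl , u≢v ← ∈-arcs⁻ uv∈ =
    clique i (gate∈block i r) (gate∈block i s) u≢v

  -- `S` is included outright, which makes containment of `S` immediate; the rest are ends of tree
  -- edges.
  TreeVertex : Fin n → Set
  TreeVertex u = u ∈ˢ S ⊎ ∃ (TreeEdge u)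

  treeVertex? : ∀ u → Dec (TreeVertex u)
  treeVertex? u = (u ∈? S) ⊎-dec any? (treeEdge? u)

  tree : Subgraph G
  tree = record
    { V     = comprehension treeVertex?
    ; E     = TreeEdge
    ; E?    = treeEdge?
    ; E-sym = TreeEdge-sym
    ; E⇒~   = Sum.[ arc⇒~ , ~-sym ∘ arc⇒~ ]
    ; E⇒V   = λ e → ∈-comprehension⁺ treeVertex? (inj₂ (_ , e))
                  , ∈-comprehension⁺ treeVertex? (inj₂ (_ , TreeEdge-sym e))
    }

  Turn⇒TreeEdge : ∀ {s} → s ∈ˢ S → Turn r s ⇒ TreeEdge
  Turn⇒TreeEdge s∈S = inj₁ ∘ ∈-arcs⁺ s∈S

  arc-reachable : ∀ {u v} → (u , v) ∈ arcs → Star TreeEdge r u × Star TreeEdge r v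
  arc-reachable uv∈ with s , s∈S , i , refl , refl , u≢v ← ∈-arcs⁻ uv∈ =
    r→u , r→u ◅◅ inj₁ uv∈ ◅ ε
    where
    r→u = Star.map (Turn⇒TreeEdge s∈S)
      -- The path from `r` to `s` is cut at its edge in block `i`. That edge cannot be missing,
      -- because the gates of `r` and `s` there are the distinct ends of the arc.
      (toGate i (λ _ _ → refl) (λ eq → contradiction (sym eq) u≢v) refl (geodesic r s))

  reachable : ∀ {u} → u ∈ˢ comprehension treeVertex? → Star TreeEdge r u
  reachable u∈V with ∈-comprehension⁻ treeVertex? u∈V
  ... | inj₁ u∈S              = Star.map (Turn⇒TreeEdge u∈S) (geodesic r _)
  ... | inj₂ (_ , inj₁ uv∈) = proj₁ (arc-reachable uv∈)
  ... | inj₂ (_ , inj₂ vu∈) = proj₂ (arc-reachable vu∈)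

  tree-connected : Subgraph.ConnectedContaining tree S
  tree-connected =
    ((r , S⊆V r∈S) , λ u∈V v∈V → Star.reverse TreeEdge-sym (reachable u∈V) ◅◅ reachable v∈V)
    , S⊆V
    where
    S⊆V : S ⊆ comprehension treeVertex?
    S⊆V = ∈-comprehension⁺ treeVertex? ∘ inj₁

  -- Arcs point away from the gate of `r`, whereas `size` counts each edge with its smaller end
  -- first.
  orient : Fin n × Fin n → Fin n × Fin n
  orient (u , v) with u <? v
  ... | yes _ = u , v
  ... | no  _ = v , u

  orient-< : ∀ {u v} → u Fin.< v → orient (u , v) ≡ (u , v)
  orient-< {u} {v} u<v with u <? v
  ... | yes _   = refl
  ... | no  u≮v = contradiction u<v u≮v

  orient-> : ∀ {u v} → u Fin.< v → orient (v , u) ≡ (u , v)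
  orient-> {u} {v} u<v with v <? u
  ... | yes v<u = contradiction v<u (<-asym u<v)
  ... | no  _   = refl

  size-tree-≤ : Subgraph.size tree ≤ length arcs
  size-tree-≤ = ℕ.≤-trans
    (Unique-⊆⇒length-≤ _≟ₑ_ (filter⁺ _ (cartesianProduct⁺ (allFin⁺ n) (allFin⁺ n))) covered)
    (ℕ.≤-reflexive (length-map orient arcs))
    where
    covered : edges tree ⊆ˡ map orient arcs
    covered uv∈ with ∈-filter⁻ _ {xs = cartesianProduct (allFin n) (allFin n)} uv∈
    ... | _ , u<v , inj₁ arc = subst (_∈ map orient arcs) (orient-< u<v) (∈-map⁺ orient arc)
    ... | _ , u<v , inj₂ arc = subst (_∈ map orient arcs) (orient-> u<v) (∈-map⁺ orient arc)

  gates≤ : (H : Subgraph G) → Subgraph.ConnectedContaining H S →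
           ∑[ i < t ] gates i elements ≤ t + Subgraph.size H
  gates≤ H ((_ , walk) , S⊆V) = ∑-gates-≤-size {r} elements
    (All.tabulate λ s∈ → walk (S⊆V r∈S) (S⊆V (∈-elements⁻ s∈)))
    where open Exploration conn isBlockGraph blocks H

  tree-minimal : t + Subgraph.size tree ≤ ∑[ i < t ] gates i elements
  tree-minimal = ℕ.≤-trans (ℕ.+-monoʳ-≤ t size-tree-≤) length-arcs

  -- The gate total lies between `t` plus the size of the tree and `t` plus the size of any
  -- competitor `H`; cancelling `t` gives minimality.
  isSteinerDistance : IsSteinerDistance G S (Subgraph.size tree)
  isSteinerDistance = (tree , tree-connected , refl) ,
    λ H H-conn → ℕ.+-cancelˡ-≤ t _ _ (ℕ.≤-trans tree-minimal (gates≤ H H-conn))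

  -- The lower bound applies to the tree itself, so the estimate from the construction is an
  -- equality.
  size-tree : t + Subgraph.size tree ≡ ∑[ i < t ] gates i elements
  size-tree = ℕ.≤-antisym tree-minimal (gates≤ tree tree-connected)

-- The formula over the integers

∣p∣>0⇒Nonempty : {p : Subset n} → 0 < ∣ p ∣ → Nonempty p
∣p∣>0⇒Nonempty {n} {p} 0<∣p∣ = decidable-stable (nonempty? p) λ empty →
  ℕ.<⇒≢ 0<∣p∣ (sym (trans (cong ∣_∣ (Empty-unique empty)) (∣⊥∣≡0 n)))

theorem2 : ∀ {n t k : ℕ} (G : Graph n) (conn : Connected G) → IsBlockGraph G →
    (blocks : BlockEnumeration G t) (labelling : HammingLabelling conn blocks) →
    (S : Subset n) → ∣ S ∣ ≡ k → 2 ≤ k → k ≤ n →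
    ∃[ d ] IsSteinerDistance G S d
    × + d ≡ + (∑[ i < t ] HammingLabelling.ℓ labelling i S) - + t
theorem2 {t = t} G conn isBlockGraph blocks labelling S refl 2≤∣S∣ _
  = d , isSteinerDistance , (begin
    + d                                       ≡⟨ cong +_ (ℕ.m+n∸m≡n t d) ⟨
    + (t + d ∸ t)                             ≡⟨ ℤ.⊖-≥ (ℕ.m≤m+n t d) ⟨
    t + d ⊖ t                                 ≡⟨ ℤ.m-n≡m⊖n (t + d) t ⟨
    + (t + d) - + t                           ≡⟨ cong (λ m → + m - + t)
                                                   (trans size-tree (sum-cong-≗ (gates≡ℓ labelling S))) ⟩
    + (∑[ i < t ] ℓ i S) - + t                ∎)
  where
  open ≡-Reasoning
  open HammingLabelling labelling using (ℓ)
  open Gates G conn isBlockGraph blocks using (gates≡ℓ)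
  -- The root `r` is any vertex of `S`, which exists because `S` has at least two elements.
  open SteinerTree G conn isBlockGraph blocks S (proj₂ (∣p∣>0⇒Nonempty (ℕ.<⇒≤ 2≤∣S∣)))
  d = Subgraph.size tree
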